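{- Embedded $\mathrm{W}[1]$-parameterized Resolution is not fpt-bounded. That is, there exist no computable function $f:\mathbb{N}\to\mathbb{N}$ and constant $c$ such that for every weighted parameterized contradiction $(\Phi,k)$ in 3-CNF, with $\Phi$ in $n$ variables and $0\le k\le n$, the CNF $\Phi'$ obtained by adding to $\Phi$ the pigeonhole clauses that enforce that exactly $k$ variables are true has a Resolution refutation of size at most $f(k)\cdot|\Phi|^{c}$.
   Context: $[n]:=\{1,\ldots,n\}$. $|\Phi|$ denotes the size of (an encoding of) $\Phi$. A 3-CNF is a CNF with at most three literals per clause. The weight of an assignment is the number of variables it sets to true. A weighted parameterized contradiction in 3-CNF is a pair $(\Phi,k)$ where $\Phi$ is a 3-CNF with no satisfying assignment of weight exactly $k$. Given such $(\Phi,k)$ with $\Phi$ in variables $x_1,\ldots,x_n$, the CNF $\Phi'$ has additional variables $r_{x_i,j}$ ($i\in[n]$, $j\in[k]$) and $s_{x_i,j}$ ($i\in[n]$, $j\in[n-k]$). Its clauses are those of $\Phi$ together with $$\neg x_i\vee\bigvee_{l=1}^{k} r_{x_i,l}\quad(i\in[n]),\qquad \neg x_i\vee\neg r_{x_i,j}\vee\neg r_{x_l,j}\quad(i\neq l\in[n],\ j\in[k]),$$ $$x_i\vee\bigvee_{l=1}^{n-k} s_{x_i,l}\quad(i\in[n]),\qquad x_i\vee\neg s_{x_i,j}\vee\neg s_{x_l,j}\quad(i\neq l\in[n],\ j\in[n-k]).$$ An embedded $\mathrm{W}[1]$-parameterized Resolution refutation of $(\Phi,k)$ is an ordinary Resolution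 refutation of $\Phi'$. Resolution is a refutation system for unsatisfiable CNFs, operating on clauses. Its rules are: the resolution rule (from $P\vee x$ and $Q\vee\neg x$ derive $P\vee Q$, where $P,Q$ are disjunctions of literals) and weakening (from $P$ derive $P\vee l$ for a literal $l$). A refutation is a DAG whose sources are labelled by initial clauses, whose internal nodes are labelled by clauses derived from their predecessors by one of these rules, and whose unique sink is labelled by the empty clause. The size of a refutation is the number of nodes of this DAG. A proof system for a parameterized language $L\subseteq\Sigma^*\times\mathbb{N}$ is fpt-bounded if there are a computable function $f$ and a constant $c$ such that each $(x,k)\in L$ has a proof of size at most $f(k)\cdot|x|^{c}$. -}

module Defs where

open import Data.Bool.Base using (Bool; true; not)
open import Data.Fin.Base using (Fin; toℕ)
open import Data.Fin.Properties using (_≟_)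
open import Data.Fin.Subset using (∣_∣)
open import Data.List.Base
  using (List; []; _∷_; _++_; map; concatMap; filter; allFin; replicate; length)
open import Data.List.Membership.Propositional using (_∈_)
open import Data.List.Relation.Binary.BagAndSetEquality using (_∼[_]_; set)
open import Data.List.Relation.Unary.All using (All)
open import Data.List.Relation.Unary.Any using (Any)
open import Data.Nat.Base using (ℕ; zero; suc; _∸_; _≤_; _<_)
open import Data.Nat.Binary.Base using (ℕᵇ; 2[1+_]; 1+[2_]) renaming (zero to 0ᵇ; fromℕ to toBinary)
open import Data.Product.Base using (∃-syntax)
open import Data.Vec.Base using (Vec; []; _∷_; lookup; tabulate)
open import Relation.Binary.Construct.Closure.Transitive using (TransClosure)
open import Relation.Binary.PropositionalEquality.Core using (_≡_)
open import Relation.Nullary using (¬_; ¬?)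

private
  variable
    V W : Set
    m n : ℕ

-- Computability is made explicit through μ-recursive functions, since ℕ → ℕ
-- also has models containing non-computable functions.
data Rec : ℕ → Set where
  zeroᶠ : Rec 0
  sucᶠ  : Rec 1
  projᶠ : Fin n → Rec n
  compᶠ : Rec m → Vec (Rec n) m → Rec n
  precᶠ : Rec n → Rec (suc (suc n)) → Rec (suc n)
  minᶠ  : Rec (suc n) → Rec n

infix 4 _[_]⇓_

data _[_]⇓_ : Rec n → Vec ℕ n → ℕ → Set where
  ⇓zero  : zeroᶠ [ [] ]⇓ 0
  ⇓suc   : ∀ {x} → sucᶠ [ x ∷ [] ]⇓ suc x
  ⇓proj  : ∀ {i : Fin n} {xs} → projᶠ i [ xs ]⇓ lookup xs i
  ⇓comp  : ∀ {g : Rec m} {hs : Vec (Rec n) m} {xs ys z} →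
           (∀ i → lookup hs i [ xs ]⇓ lookup ys i) → g [ ys ]⇓ z →
           compᶠ g hs [ xs ]⇓ z
  ⇓prec0 : ∀ {g : Rec n} {h xs z} →
           g [ xs ]⇓ z → precᶠ g h [ 0 ∷ xs ]⇓ z
  ⇓precS : ∀ {g : Rec n} {h xs t y z} →
           precᶠ g h [ t ∷ xs ]⇓ y → h [ t ∷ y ∷ xs ]⇓ z →
           precᶠ g h [ suc t ∷ xs ]⇓ z
  ⇓min   : ∀ {g : Rec (suc n)} {xs t} →
           (∀ u → u < t → ∃[ y ] g [ u ∷ xs ]⇓ suc y) → g [ t ∷ xs ]⇓ 0 →
           minᶠ g [ xs ]⇓ t

Computable : (ℕ → ℕ) → Set
Computable f = ∃[ e ] (∀ x → e [ x ∷ [] ]⇓ f x)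

data Literal (V : Set) : Set where
  pos neg : V → Literal V

mapLiteral : (V → W) → Literal V → Literal W
mapLiteral g (pos v) = pos (g v)
mapLiteral g (neg v) = neg (g v)

Clause : Set → Set
Clause V = List (Literal V)

CNF : Set → Set
CNF V = List (Clause V)

-- Disjunctions are identified up to associativity, commutativity and
-- idempotence.
infix 4 _≈_
_≈_ : Clause V → Clause V → Set
C ≈ D = C ∼[ set ] D

Is3CNF : CNF V → Set
Is3CNF = All (λ C → length C ≤ 3)

eval : (V → Bool) → Literal V → Bool
eval α (pos v) = α v
eval α (neg v) = not (α v)

infix 4 _⊨_
_⊨_ : (V → Bool) → CNF V → Set
α ⊨ Φ = All (Any (λ l → eval α l ≡ true)) Φ

weight : (Fin n → Bool) → ℕ
weight α = ∣ tabulate α ∣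

WeightedContradiction : CNF (Fin n) → ℕ → Set
WeightedContradiction {n} Φ k = (α : Fin n → Bool) → weight α ≡ k → ¬ (α ⊨ Φ)

data Symbol : Set where
  variable! clause! plus minus one two : Symbol

-- Bijective base-2 numerals, least significant digit first.
encodeℕᵇ : ℕᵇ → List Symbol
encodeℕᵇ 0ᵇ       = []
encodeℕᵇ 2[1+ b ] = two ∷ encodeℕᵇ b
encodeℕᵇ 1+[2 b ] = one ∷ encodeℕᵇ b

encodeLiteral : Literal (Fin n) → List Symbol
encodeLiteral (pos i) = plus  ∷ encodeℕᵇ (toBinary (toℕ i))
encodeLiteral (neg i) = minus ∷ encodeℕᵇ (toBinary (toℕ i))

encodeClause : Clause (Fin n) → List Symbol
encodeClause C = clause! ∷ concatMap encodeLiteral C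

-- The number of variables is declared in unary, so that variables not
-- occurring in any clause also contribute to the size.
encode : CNF (Fin n) → List Symbol
encode {n} Φ = replicate n variable! ++ concatMap encodeClause Φ

∥_∥ : CNF (Fin n) → ℕ
∥ Φ ∥ = length (encode Φ)

data Var′ (n k : ℕ) : Set where
  xᵛ : Fin n → Var′ n k
  rᵛ : Fin n → Fin k → Var′ n k
  sᵛ : Fin n → Fin (n ∸ k) → Var′ n k

-- Ranges over ordered pairs of distinct indices.
distinctPairs : (n : ℕ) → (Fin n → Fin n → List V) → List V
distinctPairs n g =
  concatMap (λ i → concatMap (g i) (filter (λ l → ¬? (i ≟ l)) (allFin n))) (allFin n)

embed : CNF (Fin n) → (k : ℕ) → CNF (Var′ n k)
embed {n} Φ k =
     map (map (mapLiteral xᵛ)) Φ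
  ++ map (λ i → neg (xᵛ i) ∷ map (λ l → pos (rᵛ i l)) (allFin k)) (allFin n)
  ++ distinctPairs n (λ i l →
       map (λ j → neg (xᵛ i) ∷ neg (rᵛ i j) ∷ neg (rᵛ l j) ∷ []) (allFin k))
  ++ map (λ i → pos (xᵛ i) ∷ map (λ l → pos (sᵛ i l)) (allFin (n ∸ k))) (allFin n)
  ++ distinctPairs n (λ i l →
       map (λ j → pos (xᵛ i) ∷ neg (sᵛ i j) ∷ neg (sᵛ l j) ∷ []) (allFin (n ∸ k)))

data Inference (F : CNF V) (label : Fin m → Clause V) (i : Fin m) : Set where
  initial : Any (label i ≈_) F → Inference F label i
  resolve : (p q : Fin m) (P Q : Clause V) (v : V) →
            label p ≈ pos v ∷ P → label q ≈ neg v ∷ Q → label i ≈ P ++ Q →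
            Inference F label i
  weaken  : (p : Fin m) (l : Literal V) →
            label i ≈ l ∷ label p →
            Inference F label i

predecessors : {F : CNF V} {label : Fin m → Clause V} {i : Fin m} →
               Inference F label i → List (Fin m)
predecessors (initial _)             = []
predecessors (resolve p q _ _ _ _ _ _) = p ∷ q ∷ []
predecessors (weaken p _ _)          = p ∷ []

record Refutation (F : CNF V) : Set where
  field
    size      : ℕ
    label     : Fin size → Clause V
    inference : (i : Fin size) → Inference F label i

  Edge : Fin size → Fin size → Set
  Edge p i = p ∈ predecessors (inference i)

  IsSink : Fin size → Set
  IsSink i = ∀ j → ¬ Edge i j

  field
    acyclic     : ∀ i → ¬ TransClosure Edge i i
    sink        : Fin size
    sink-isSink : IsSink sink
    sink-unique : ∀ i → IsSink i → i ≡ sink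
    sink-empty  : label sink ≡ []

open Refutation public using (size)

{-# OPTIONS --safe #-}
module Submission where

-- Taking k = 1 and Φ = ¬x₁ ∧ … ∧ ¬xₙ, the s-clauses of Φ′ form the pigeonhole
-- principle with n pigeons and n - 1 holes once all x are false, so that
-- Haken's exponential lower bound applies. The argument is the one of Beame
-- and Pitassi, phrased semantically over the critical assignments, which place
-- all pigeons but one bijectively. On these, every clause without ¬x and ¬r
-- literals is equivalent to a set of cells (i , j). In any refutation, and
-- under any restriction ρ that leaves at least 3q pigeons free, some clause
-- not satisfied by ρ has at least q² free cells: a clause falsified by
-- i-critical assignments for between q and 2q pigeons i. On the other hand,
-- greedily placing a pigeon at the cell that occurs in most of the clauses
-- with at least q² free cells kills at least a 1/25 fraction of them, so if
-- there were fewer than (25/24)^q such clauses then q ≤ n/4 rounds would kill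
-- all of them.

import Algebra.Properties.Semiring.Sum as Sum
open import Data.Bool.Base using (Bool; true; false; not; _∧_; _∨_)
open import Data.Bool.ListAction using (any)
open import Data.Bool.Properties
  using (∧-conicalˡ; ∧-conicalʳ; ∨-conicalˡ; ∨-conicalʳ; not-injective; ¬-not)
open import Data.Empty using (⊥)
open import Data.Fin.Base using (Fin; zero; suc; toℕ)
import Data.Fin.Induction as Fin
import Data.Fin.Permutation as Perm
open import Data.Fin.Permutation
  using (Permutation′; _⟨$⟩ʳ_; _⟨$⟩ˡ_; _∘ₚ_; transpose; inverseˡ; inverseʳ)
import Data.Fin.Properties as Fin
open import Data.Fin.Properties using (_≟_)
open import Data.List.Base using (List; []; _∷_; _++_; map; allFin; length; concatMap; replicate)
open import Data.List.Membership.Propositional using (_∈_)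
open import Data.List.Properties
  using (length-++; ++-identityʳ; length-replicate; length-map; length-tabulate)
open import Data.List.Relation.Unary.All as All using (All; []; _∷_)
import Data.List.Relation.Unary.All.Properties as All
open import Data.List.Relation.Unary.Any using (Any; here; there)
open import Data.Nat.Base
open import Data.Nat.Binary.Base as ℕᵇ using (2[1+_]; 1+[2_])
open import Data.Nat.Binary.Properties using (toℕ-fromℕ)
open import Data.Nat.Properties hiding (_≟_)
open import Data.Nat.Tactic.RingSolver using (solve-∀)
open import Data.Product.Base using (Σ-syntax; ∃-syntax; _×_; _,_; proj₁; proj₂)
import Data.Product.Base as Product
open import Data.Sum.Base using (_⊎_; inj₁; inj₂)
open import Effect.Monad using (RawMonad)
open import Function.Base using (_∘_; id; case_of_)
open import Function.Bundles using (Equivalence)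
import Function.Properties.Equivalence as ⇔
open import Induction.WellFounded using (WellFounded; Acc; acc)
open import Relation.Binary.Construct.Closure.Transitive as Plus using (TransClosure; [_])
open import Relation.Binary.PropositionalEquality
open import Relation.Nullary using (¬_; ¬?; Dec; yes; no; contradiction)
open import Relation.Nullary.Decidable
  using (⌊_⌋; dec-true; dec-false; isYes≗does; ¬¬-excluded-middle)
open import Relation.Nullary.Negation using (¬¬-Monad)
open import Defs
open Sum +-*-semiring
  using (sum; ∑-comm; ∑-distrib-+; sum-permute; sum-cong-≗; *-distribˡ-sum; *-distribʳ-sum)

private
  variable
    m n : ℕ
    V : Set

-- Sums over `Fin n` and counting.

sum-mono : {f g : Fin n → ℕ} → (∀ i → f i ≤ g i) → sum f ≤ sum g
sum-mono {zero}  f≤g = z≤n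
sum-mono {suc n} f≤g = +-mono-≤ (f≤g zero) (sum-mono (f≤g ∘ suc))

sum-positive : (f : Fin n → ℕ) → 0 < sum f → ∃[ i ] 0 < f i
sum-positive {suc n} f 0<s with f zero in eq
... | suc _ = zero , subst (0 <_) (sym eq) z<s
... | zero  with sum-positive (f ∘ suc) 0<s
...   | i , 0<fi = suc i , 0<fi

above-average : (f : Fin (suc n) → ℕ) (N : ℕ) → suc n * N ≤ sum f → ∃[ i ] N ≤ f i
above-average {zero} f N le = zero , subst₂ _≤_ (+-identityʳ N) (+-identityʳ (f zero)) le
above-average {suc n} f N le with N ≤? f zero
... | yes N≤f₀ = zero , N≤f₀
... | no  N≰f₀ = Product.map suc id (above-average {n} (f ∘ suc) N
                   (+-cancelˡ-≤ N _ _ (≤-trans le (+-monoˡ-≤ _ (≰⇒≥ N≰f₀)))))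

⟦_⟧ : Bool → ℕ
⟦ true  ⟧ = 1
⟦ false ⟧ = 0

0<⟦⟧⇒true : ∀ {b} → 0 < ⟦ b ⟧ → b ≡ true
0<⟦⟧⇒true {true} _ = refl

count : (Fin n → Bool) → ℕ
count p = sum (⟦_⟧ ∘ p)

count-empty : (p : Fin n → Bool) → (∀ i → p i ≡ false) → count p ≡ 0
count-empty {zero}  p empty = refl
count-empty {suc n} p empty = cong₂ _+_ (cong ⟦_⟧ (empty zero)) (count-empty (p ∘ suc) (empty ∘ suc))

count-full : (p : Fin n → Bool) → (∀ i → p i ≡ true) → count p ≡ n
count-full {zero}  p full = refl
count-full {suc n} p full = cong₂ _+_ (cong ⟦_⟧ (full zero)) (count-full (p ∘ suc) (full ∘ suc))

count-∪ : (p q r : Fin n → Bool) → (∀ i → p i ≡ true → q i ≡ true ⊎ r i ≡ true) →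
          count p ≤ count q + count r
count-∪ p q r p⊆q∪r =
  ≤-trans (sum-mono bound) (≤-reflexive (∑-distrib-+ (⟦_⟧ ∘ q) (⟦_⟧ ∘ r)))
  where
  bound : ∀ i → ⟦ p i ⟧ ≤ ⟦ q i ⟧ + ⟦ r i ⟧
  bound i with p i | p⊆q∪r i
  ... | false | _ = z≤n
  ... | true  | h with h refl
  ...   | inj₁ e rewrite e = s≤s z≤n
  ...   | inj₂ e rewrite e = m≤n+m 1 ⟦ q i ⟧

count-mono : (p q : Fin n → Bool) → (∀ i → p i ≡ true → q i ≡ true) → count p ≤ count q
count-mono p q p⊆q = sum-mono bound
  where
  bound : ∀ i → ⟦ p i ⟧ ≤ ⟦ q i ⟧
  bound i with p i | p⊆q i
  ... | false | _ = z≤n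
  ... | true  | h rewrite h refl = ≤-refl

true≢false : ∀ {b} → b ≡ true → ¬ b ≡ false
true≢false refl ()

count-unique : (p : Fin n) (q : Fin n → Bool) → (∀ i → q i ≡ true → i ≡ p) → count q ≤ 1
count-unique zero q unique =
  +-mono-≤ ⟦⟧≤1 (≤-reflexive (count-empty (q ∘ suc) λ i → ¬-not (λ e → contradiction (unique (suc i) e) λ ())))
  where
  ⟦⟧≤1 : ∀ {b} → ⟦ b ⟧ ≤ 1
  ⟦⟧≤1 {true}  = ≤-refl
  ⟦⟧≤1 {false} = z≤n
count-unique {suc n} (suc p) q unique with q zero in eq
... | true  = contradiction (unique zero eq) λ ()
... | false = count-unique p (q ∘ suc) λ i e → Fin.suc-injective (unique (suc i) e)

count-inhabited : (p : Fin n → Bool) (i : Fin n) → p i ≡ true → 0 < count p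
count-inhabited p zero e rewrite e = s≤s z≤n
count-inhabited p (suc i) e = ≤-trans (count-inhabited (p ∘ suc) i e) (m≤n+m _ ⟦ p zero ⟧)

⌊⌋-true : {P : Set} (P? : Dec P) → P → ⌊ P? ⌋ ≡ true
⌊⌋-true P? p = trans (isYes≗does P?) (dec-true P? p)

⌊⌋-false : {P : Set} (P? : Dec P) → ¬ P → ⌊ P? ⌋ ≡ false
⌊⌋-false P? ¬p = trans (isYes≗does P?) (dec-false P? ¬p)

⌊⌋-true⁻¹ : {P : Set} (P? : Dec P) → ⌊ P? ⌋ ≡ true → P
⌊⌋-true⁻¹ (yes p) _ = p

⌊⌋-false⁻¹ : {P : Set} (P? : Dec P) → ⌊ P? ⌋ ≡ false → ¬ P
⌊⌋-false⁻¹ (no ¬p) _ = ¬p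

-- Permutations and transpositions.

⟨$⟩ʳ-injective : (π : Permutation′ n) {i j : Fin n} → π ⟨$⟩ʳ i ≡ π ⟨$⟩ʳ j → i ≡ j
⟨$⟩ʳ-injective π e = trans (sym (inverseˡ π)) (trans (cong (π ⟨$⟩ˡ_) e) (inverseˡ π))

transpose-left : (i j : Fin n) → transpose i j ⟨$⟩ʳ i ≡ j
transpose-left i j rewrite dec-true (i ≟ i) refl = refl

transpose-right : (i j : Fin n) → transpose i j ⟨$⟩ʳ j ≡ i
transpose-right i j with j ≟ i
... | yes e = e
... | no _ rewrite dec-true (j ≟ j) refl = refl

transpose-other : (i j : Fin n) {l : Fin n} → l ≢ i → l ≢ j → transpose i j ⟨$⟩ʳ l ≡ l
transpose-other i j {l} l≢i l≢j rewrite dec-false (l ≟ i) l≢i | dec-false (l ≟ j) l≢j = refl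

-- Critical assignments and monotone forms of clauses.

-- A permutation π of the n pigeons describes a critical assignment: pigeon i
-- sits in hole j when π i = suc j, and the pigeon sent to zero has no hole.
assignment : Permutation′ (suc m) → Var′ (suc m) 1 → Bool
assignment π (xᵛ _)   = false
assignment π (rᵛ _ _) = false
assignment π (sᵛ i j) = ⌊ π ⟨$⟩ʳ i ≟ suc j ⌋

Falsifies : (V → Bool) → Clause V → Set
Falsifies α = All (λ l → eval α l ≡ false)

falsifies-resp-≈ : {α : V → Bool} {C D : Clause V} → C ≈ D → Falsifies α C → Falsifies α D
falsifies-resp-≈ C≈D αC = All.tabulate λ l∈D → All.lookup αC (Equivalence.from C≈D l∈D)

-- For j ≠ zero: whether π i = j makes the literal true for every permutation π.
-- For j = zero it is always false, although negative literals of i do hold then.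
forces : Fin (suc m) → Fin (suc m) → Literal (Var′ (suc m) 1) → Bool
forces i j (pos (sᵛ a b)) = ⌊ a ≟ i ⌋ ∧ ⌊ suc b ≟ j ⌋
forces i j (neg (sᵛ a b)) = not ⌊ a ≟ i ⌋ ∧ ⌊ suc b ≟ j ⌋
forces i j _              = false

-- The clause in which each ¬ s a b is replaced by the disjunction of all s i b
-- with i ≠ a, as a set of cells. The x- and r-literals are constant on the
-- assignments above and are dropped: only falsified clauses matter.
monotone : Clause (Var′ (suc m) 1) → Fin (suc m) → Fin (suc m) → Bool
monotone C i j = any (forces i j) C

monotone-zero : (C : Clause (Var′ (suc m) 1)) (i : Fin (suc m)) → monotone C i zero ≡ false
monotone-zero []      i = refl
monotone-zero (l ∷ C) i = cong₂ _∨_ (lemma l) (monotone-zero C i)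
  where
  lemma : ∀ l → forces i zero l ≡ false
  lemma (pos (xᵛ _)) = refl
  lemma (pos (rᵛ _ _)) = refl
  lemma (pos (sᵛ a _)) with ⌊ a ≟ i ⌋
  ... | true = refl
  ... | false = refl
  lemma (neg (xᵛ _)) = refl
  lemma (neg (rᵛ _ _)) = refl
  lemma (neg (sᵛ a _)) with ⌊ a ≟ i ⌋
  ... | true = refl
  ... | false = refl

-- If ¬ s a b is falsified, then pigeon `a` occupies hole `b`, so by injectivity no other pigeon
-- does.
forces-sound : (π : Permutation′ (suc m)) (i : Fin (suc m)) (l : Literal (Var′ (suc m) 1)) →
               eval (assignment π) l ≡ false → forces i (π ⟨$⟩ʳ i) l ≡ false
forces-sound π i (pos (xᵛ _))   _ = refl
forces-sound π i (pos (rᵛ _ _)) _ = refl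
forces-sound π i (neg (xᵛ _))   _ = refl
forces-sound π i (neg (rᵛ _ _)) _ = refl
forces-sound π i (pos (sᵛ a b)) e with a ≟ i
... | no  _    = refl
... | yes refl = ⌊⌋-false _ (⌊⌋-false⁻¹ (π ⟨$⟩ʳ a ≟ suc b) e ∘ sym)
forces-sound π i (neg (sᵛ a b)) e with a ≟ i
... | yes _   = refl
... | no  a≢i = ⌊⌋-false _ λ b≡πi →
  a≢i (⟨$⟩ʳ-injective π (trans (⌊⌋-true⁻¹ (π ⟨$⟩ʳ a ≟ suc b) (not-injective e)) b≡πi))

monotone-sound : (π : Permutation′ (suc m)) (i : Fin (suc m)) (C : Clause (Var′ (suc m) 1)) →
                 Falsifies (assignment π) C → monotone C i (π ⟨$⟩ʳ i) ≡ false
monotone-sound π i []      _        = refl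
monotone-sound π i (l ∷ C) (e ∷ αC) = cong₂ _∨_ (forces-sound π i l e) (monotone-sound π i C αC)

swap : Fin n → Fin n → Permutation′ n → Permutation′ n
swap i l π = transpose i l ∘ₚ π

module _ (π : Permutation′ (suc m)) {i : Fin (suc m)} (πi≡0 : π ⟨$⟩ʳ i ≡ zero) (l : Fin (suc m)) where

  swap-right : swap i l π ⟨$⟩ʳ l ≡ zero
  swap-right = trans (cong (π ⟨$⟩ʳ_) (transpose-right i l)) πi≡0

  -- The swap takes the hole of `l` away and gives it to `i`. A false literal can thus only become
  -- true because `i` enters that hole or `l` leaves it, and `forces` records both events.
  forces-complete : (L : Literal (Var′ (suc m) 1)) → eval (assignment π) L ≡ false →
                    forces i (π ⟨$⟩ʳ l) L ≡ false → eval (assignment (swap i l π)) L ≡ false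
  forces-complete (pos (xᵛ _))   e _ = e
  forces-complete (pos (rᵛ _ _)) e _ = e
  forces-complete (neg (xᵛ _))   e _ = e
  forces-complete (neg (rᵛ _ _)) e _ = e
  forces-complete (pos (sᵛ a b)) e f with a ≟ i
  ... | yes refl = ⌊⌋-false _ λ πl → ⌊⌋-false⁻¹ (suc b ≟ π ⟨$⟩ʳ l) f (sym πl)
  ... | no  _ with a ≟ l
  ...   | yes _ = ⌊⌋-false _ λ πi → case trans (sym πi) πi≡0 of λ ()
  ...   | no  _ = e
  forces-complete (neg (sᵛ a b)) e f with ⌊⌋-true⁻¹ (π ⟨$⟩ʳ a ≟ suc b) (not-injective e) | a ≟ i
  ... | πa | yes refl = case trans (sym πa) πi≡0 of λ ()
  ... | πa | no _ with a ≟ l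
  ...   | yes refl = contradiction (sym πa) (⌊⌋-false⁻¹ (suc b ≟ π ⟨$⟩ʳ l) f)
  ...   | no  _    = e

  -- Used in contrapositive: if `C` is falsified while `i` has no hole, but no longer after the swap
  -- that leaves `l` without one, then the cell (i , π l) belongs to `monotone C`.
  monotone-complete : (C : Clause (Var′ (suc m) 1)) → Falsifies (assignment π) C →
                      monotone C i (π ⟨$⟩ʳ l) ≡ false → Falsifies (assignment (swap i l π)) C
  monotone-complete []      _        _ = []
  monotone-complete (L ∷ C) (e ∷ αC) f =
    forces-complete L e (∨-conicalˡ _ _ f) ∷
    monotone-complete C αC (∨-conicalʳ (forces i (π ⟨$⟩ʳ l) L) _ f)

-- The contradiction and its embedded clauses.

noneTrue : (n : ℕ) → CNF (Fin n)
noneTrue n = map (λ i → neg i ∷ []) (allFin n)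

distinctPairs⁺ : {P : V → Set} (g : Fin n → Fin n → List V) →
                 (∀ i l → i ≢ l → All P (g i l)) → All P (distinctPairs n g)
distinctPairs⁺ {n = n} g all =
  All.concat⁺ (All.map⁺ (All.tabulate⁺ λ i →
  All.concat⁺ (All.map⁺ (All.map (all i _) (All.all-filter (λ l → ¬? (i ≟ l)) (allFin n))))))

embed⁺ : {k : ℕ} {Φ : CNF (Fin n)} {P : Clause (Var′ n k) → Set} →
         All (P ∘ map (mapLiteral xᵛ)) Φ →
         (∀ i → P (neg (xᵛ i) ∷ map (λ l → pos (rᵛ i l)) (allFin k))) →
         (∀ i l j → i ≢ l → P (neg (xᵛ i) ∷ neg (rᵛ i j) ∷ neg (rᵛ l j) ∷ [])) →
         (∀ i → P (pos (xᵛ i) ∷ map (λ l → pos (sᵛ i l)) (allFin (n ∸ k)))) →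
         (∀ i l j → i ≢ l → P (pos (xᵛ i) ∷ neg (sᵛ i j) ∷ neg (sᵛ l j) ∷ [])) →
         All P (embed Φ k)
embed⁺ clauses r-some r-distinct s-some s-distinct =
  All.++⁺ (All.map⁺ clauses)
  (All.++⁺ (All.map⁺ (All.tabulate⁺ r-some))
  (All.++⁺ (distinctPairs⁺ _ λ i l i≢l → All.map⁺ (All.tabulate⁺ λ j → r-distinct i l j i≢l))
  (All.++⁺ (All.map⁺ (All.tabulate⁺ s-some))
  (distinctPairs⁺ _ λ i l i≢l → All.map⁺ (All.tabulate⁺ λ j → s-distinct i l j i≢l)))))

-- Only the clauses that demand a hole for some pigeon `i` can be falsified here, and then `i` is
-- the one without a hole. The other clauses are never falsified, so their witness `zero` is
-- arbitrary.
axiom-critical : All (λ C → ∃[ i ] (∀ π → Falsifies (assignment π) C → π ⟨$⟩ʳ i ≡ zero))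
                     (embed (noneTrue (suc m)) 1)
axiom-critical {m} = embed⁺ {Φ = noneTrue (suc m)}
  (All.map⁺ (All.tabulate⁺ {f = λ i → i} λ _ → zero , λ { π (() ∷ _) }))
  (λ _ → zero , λ { π (() ∷ _) })
  (λ _ _ _ _ → zero , λ { π (() ∷ _) })
  (λ i → i , λ { π (_ ∷ αC) → unmatched π i (All.tabulate⁻ (All.map⁻ αC)) })
  (λ i l j i≢l → zero , λ { π (_ ∷ eᵢ ∷ eₗ ∷ []) → contradiction (⟨$⟩ʳ-injective π
    (trans (⌊⌋-true⁻¹ (π ⟨$⟩ʳ i ≟ suc j) (not-injective eᵢ))
    (sym (⌊⌋-true⁻¹ (π ⟨$⟩ʳ l ≟ suc j) (not-injective eₗ))))) i≢l })
  where
  unmatched : (π : Permutation′ (suc m)) (i : Fin (suc m)) →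
              (∀ j → ⌊ π ⟨$⟩ʳ i ≟ suc j ⌋ ≡ false) → π ⟨$⟩ʳ i ≡ zero
  unmatched π i none with π ⟨$⟩ʳ i
  ... | zero  = refl
  ... | suc j = contradiction refl (⌊⌋-false⁻¹ (suc j ≟ suc j) (none j))

-- Restrictions by partial matchings.

-- The partial matching ρ obtained by restricting σ to the complement of A;
-- the pigeons in A and the holes in σ(A) are still free.
record Restriction (n : ℕ) : Set where
  field
    σ : Permutation′ n
    A : Fin n → Bool

  H : Fin n → Bool
  H j = A (σ ⟨$⟩ˡ j)

  Extends : Permutation′ n → Set
  Extends π = ∀ i → A i ≡ false → π ⟨$⟩ʳ i ≡ σ ⟨$⟩ʳ i

  -- Both `π` and `σ` are bijections and they agree off `A`, so they have the same image of `A`.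
  extends-free : ∀ {π} → Extends π → ∀ i → H (π ⟨$⟩ʳ i) ≡ A i
  extends-free {π} ext i with A i in eq
  ... | false = trans (cong A (trans (cong (σ ⟨$⟩ˡ_) (ext i eq)) (inverseˡ σ))) eq
  ... | true with A (σ ⟨$⟩ˡ (π ⟨$⟩ʳ i)) in eq′
  ...   | true  = refl
  ...   | false = contradiction eq′
    (true≢false (subst (λ l → A l ≡ true) (sym l≡i) eq))
    where
    l≡i : σ ⟨$⟩ˡ (π ⟨$⟩ʳ i) ≡ i
    l≡i = ⟨$⟩ʳ-injective π (trans (ext _ eq′) (inverseʳ σ))

  extends-swap : ∀ {π i l} → Extends π → A i ≡ true → A l ≡ true → Extends (swap i l π)
  extends-swap {π} {i} {l} ext Ai Al a Aa = trans
    (cong (π ⟨$⟩ʳ_) (transpose-other i l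
      (λ { refl → true≢false Ai Aa }) (λ { refl → true≢false Al Aa })))
    (ext a Aa)

  cells : (Fin n → Fin n → Bool) → ℕ
  cells M = sum λ i → count λ j → (A i ∧ H j) ∧ M i j

  Unsatisfied : (Fin n → Fin n → Bool) → Set
  Unsatisfied M = ∀ i → A i ≡ false → M i (σ ⟨$⟩ʳ i) ≡ false

open Restriction

module _ (R : Restriction n) {i j : Fin n} (Ai : A R i ≡ true) (Hj : H R j ≡ true) where

  -- On `A` only the image of `σ` matters, not its individual values. So `i` may trade values with
  -- the free pigeon currently sent to `j` before it leaves `A`.
  place : Restriction n
  place .σ   = swap i (σ R ⟨$⟩ˡ j) (σ R)
  place .A l = A R l ∧ not ⌊ l ≟ i ⌋

  place-A⇒ : ∀ {l} → A place l ≡ true → A R l ≡ true × l ≢ i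
  place-A⇒ {l} e = ∧-conicalˡ _ _ e ,
    ⌊⌋-false⁻¹ (l ≟ i) (not-injective (∧-conicalʳ (A R l) _ e))

  place-A⇐ : ∀ {l} → A R l ≡ true → l ≢ i → A place l ≡ true
  place-A⇐ {l} e l≢i rewrite e | ⌊⌋-false (l ≟ i) l≢i = refl

  private
    extends : Extends R (σ place)
    extends = extends-swap R {σ R} (λ _ _ → refl) Ai Hj

  place-at : σ place ⟨$⟩ʳ i ≡ j
  place-at = trans (cong (σ R ⟨$⟩ʳ_) (transpose-left i _)) (inverseʳ (σ R))

  place-off : ∀ {l} → A R l ≡ false → σ place ⟨$⟩ʳ l ≡ σ R ⟨$⟩ʳ l
  place-off {l} = extends l

  place-H⇒ : ∀ {k} → H place k ≡ true → H R k ≡ true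
  place-H⇒ {k} e = trans (cong (H R) (sym (inverseʳ (σ place))))
    (trans (extends-free R {σ place} extends _) (proj₁ (place-A⇒ e)))

  place-H⇐ : ∀ {k} → H R k ≡ true → k ≢ j → H place k ≡ true
  place-H⇐ {k} e k≢j = place-A⇐
    (trans (sym (extends-free R {σ place} extends _)) (trans (cong (H R) (inverseʳ (σ place))) e))
    λ l≡i → k≢j (trans (sym (inverseʳ (σ place))) (trans (cong (σ place ⟨$⟩ʳ_) l≡i) place-at))

  place-unsatisfied⇒ : ∀ {M} → Unsatisfied place M → Unsatisfied R M × M i j ≡ false
  place-unsatisfied⇒ {M} unsat =
    (λ l Al → subst (λ k → M l k ≡ false) (place-off Al)
      (unsat l (cong (_∧ not ⌊ l ≟ i ⌋) Al))) ,
    subst (λ k → M i k ≡ false) place-at (unsat i free)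
    where
    free : A place i ≡ false
    free rewrite ⌊⌋-true (i ≟ i) refl | Ai = refl

  place-cells : ∀ M → cells place M ≤ cells R M
  place-cells M = sum-mono λ a → count-mono _ _ λ b e →
    cong₂ _∧_ (cong₂ _∧_
      (proj₁ (place-A⇒ (∧-conicalˡ _ _ (∧-conicalˡ _ _ e))))
      (place-H⇒ (∧-conicalʳ (A place a) _ (∧-conicalˡ _ _ e))))
      (∧-conicalʳ (A place a ∧ H place b) _ e)

  place-count : count (A R) ≤ suc (count (A place))
  place-count = ≤-trans
    (count-∪ (A R) (λ l → ⌊ l ≟ i ⌋) (A place) λ l Al → case l ≟ i of λ
      { (yes l≡i) → inj₁ (⌊⌋-true (l ≟ i) l≡i)
      ; (no  l≢i) → inj₂ (place-A⇐ Al l≢i) })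
    (+-monoˡ-≤ _ (count-unique i (λ l → ⌊ l ≟ i ⌋) λ l → ⌊⌋-true⁻¹ (l ≟ i)))

-- A clause with many free cells under every restriction.

module _ {m : ℕ} (ref : Refutation (embed (noneTrue (suc m)) 1)) where
  open Refutation ref hiding (size)

  M : Fin (size ref) → Fin (suc m) → Fin (suc m) → Bool
  M c = monotone (label c)

  -- A strict partial order on a finite set is well-founded, which turns `acyclic` into induction
  -- along the DAG.
  edge-wellFounded : WellFounded (TransClosure Edge)
  edge-wellFounded = Fin.spo-wellFounded record
    { isEquivalence = isEquivalence
    ; irrefl        = λ { refl → acyclic _ }
    ; trans         = Plus._++_
    ; <-resp-≈      = (λ { refl e → e }) , (λ { refl e → e })
    }

  module _ (R : Restriction (suc m)) (H-zero : H R zero ≡ true) where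

    -- The number of such `i` is the measure of a clause: at most 1 on initial clauses, subadditive
    -- under resolution, and at least the number of free pigeons at the sink.
    Critical : Fin (size ref) → Fin (suc m) → Set
    Critical c i =
      ∃[ τ ] Extends R τ × τ ⟨$⟩ʳ i ≡ zero × Falsifies (assignment τ) (label c)

    -- Only ⊥ is derived from it, so classical logic is available here.
    critical-decidable : ¬ ¬ (∀ c i → Dec (Critical c i))
    critical-decidable = sequence λ c → sequence λ i → ¬¬-excluded-middle
      where
      sequence : ∀ {n} {P : Fin n → Set} → (∀ i → ¬ ¬ P i) → ¬ ¬ (∀ i → P i)
      sequence = Fin.sequence (RawMonad.rawApplicative ¬¬-Monad)

    critical-free : ∀ {c i} → Critical c i → A R i ≡ true
    critical-free {i = i} (τ , ext , τi , _) =
      trans (sym (extends-free R {τ} ext i)) (trans (cong (H R) τi) H-zero)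

    critical-sink : ∀ {i} → A R i ≡ true → Critical sink i
    critical-sink {i} Ai =
      swap i z (σ R) , extends-swap R {σ R} (λ _ _ → refl) Ai H-zero ,
      trans (cong (σ R ⟨$⟩ʳ_) (transpose-left i z)) (inverseʳ (σ R)) ,
      subst (Falsifies _) (sym sink-empty) []
      where z = σ R ⟨$⟩ˡ zero

    critical-unsatisfied : ∀ {c i} → Critical c i → Unsatisfied R (M c)
    critical-unsatisfied {c} (τ , ext , _ , αC) l Al =
      subst (λ j → M c l j ≡ false) (ext l Al) (monotone-sound τ l (label c) αC)

    -- Otherwise swapping `i` and `l` in `τ` would show that `l` is critical.
    critical-monotone : ∀ {c i l} ((τ , _) : Critical c i) → A R l ≡ true → ¬ Critical c l →
                        M c i (τ ⟨$⟩ʳ l) ≡ true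
    critical-monotone {c} {i} {l} crit@(τ , ext , τi , αC) Al ¬crit with M c i (τ ⟨$⟩ʳ l) in eq
    ... | true  = refl
    ... | false = contradiction
      (swap i l τ , extends-swap R {τ} ext (critical-free {c} crit) Al , swap-right τ τi l ,
        monotone-complete τ τi l (label c) αC eq)
      ¬crit

    module _ (critical? : ∀ c i → Dec (Critical c i)) where

      K : Fin (size ref) → Fin (suc m) → Bool
      K c i = ⌊ critical? c i ⌋

      K⇒ : ∀ {c i} → K c i ≡ true → Critical c i
      K⇒ {c} {i} = ⌊⌋-true⁻¹ (critical? c i)

      K⇐ : ∀ {c i} → Critical c i → K c i ≡ true
      K⇐ {c} {i} = ⌊⌋-true (critical? c i)

      count-K-initial : ∀ {c} → Any (label c ≈_) (embed (noneTrue (suc m)) 1) → count (K c) ≤ 1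
      count-K-initial {c} any = helper (All.lookupAny axiom-critical any)
        where
        helper : ∀ {D} → (∃[ i ] (∀ π → Falsifies (assignment π) D → π ⟨$⟩ʳ i ≡ zero)) ×
                 label c ≈ D → count (K c) ≤ 1
        helper ((i , crit) , c≈D) = count-unique i (K c) λ l Kl → case K⇒ {c} Kl of λ
          { (τ , _ , τl , αC) → ⟨$⟩ʳ-injective τ
              (trans τl (sym (crit τ (falsifies-resp-≈ c≈D αC)))) }

      count-K-weaken : ∀ {c p l} → label c ≈ l ∷ label p → count (K c) ≤ count (K p)
      count-K-weaken {c} {p} c≈ = count-mono (K c) (K p) λ i Ki → case K⇒ {c} Ki of λ
        { (τ , ext , τi , αC) → K⇐ {p} (τ , ext , τi , All.tail (falsifies-resp-≈ c≈ αC)) }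

      -- An assignment that falsifies the conclusion also falsifies the premise whose pivot literal
      -- it makes false.
      count-K-resolve : ∀ {c p q P Q v} → label p ≈ pos v ∷ P → label q ≈ neg v ∷ Q →
                        label c ≈ P ++ Q → count (K c) ≤ count (K p) + count (K q)
      count-K-resolve {c} {p} {q} {P} {Q} {v} p≈ q≈ c≈ =
        count-∪ (K c) (K p) (K q) λ i Ki → split (K⇒ {c} Ki)
        where
        split : ∀ {i} → Critical c i → K p i ≡ true ⊎ K q i ≡ true
        split (τ , ext , τi , αC)
          with falsifies-resp-≈ c≈ αC | assignment τ v in eq
        ... | αPQ | false = inj₁ (K⇐ {p} (τ , ext , τi ,
          falsifies-resp-≈ (⇔.sym p≈) (eq ∷ All.++⁻ˡ P αPQ)))
        ... | αPQ | true = inj₂ (K⇐ {q} (τ , ext , τi ,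
          falsifies-resp-≈ (⇔.sym q≈) (cong not eq ∷ All.++⁻ʳ P αPQ)))

      module _ (q : ℕ) (3q≤A : q + (q + q) ≤ count (A R)) where

        -- Of at least 3q free pigeons at most 2q are critical, so q are not. `τ` sends these to
        -- distinct columns, and by `critical-monotone` they all give cells in row `i`.
        critical-row : ∀ {c i} → Critical c i → count (K c) ≤ q + q →
                       q ≤ count (λ j → (A R i ∧ H R j) ∧ M c i j)
        critical-row {c} {i} crit@(τ , ext , _) K≤2q = begin
          q                                                ≤⟨ +-cancelˡ-≤ (q + q) _ _ q≤ ⟩
          count (λ l → A R l ∧ not (K c l))                ≤⟨ count-mono _ _ inRow ⟩
          count (λ l → row (τ ⟨$⟩ʳ l))                     ≡⟨ sum-permute (⟦_⟧ ∘ row) τ ⟨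
          count row                                        ∎
          where
          open ≤-Reasoning
          row : Fin (suc m) → Bool
          row j = (A R i ∧ H R j) ∧ M c i j
          q≤ : q + q + q ≤ q + q + count (λ l → A R l ∧ not (K c l))
          q≤ = begin
            q + q + q       ≡⟨ +-assoc q q q ⟩
            q + (q + q)     ≤⟨ 3q≤A ⟩
            count (A R)     ≤⟨ count-∪ (A R) (K c) (λ l → A R l ∧ not (K c l)) split ⟩
            count (K c) + count (λ l → A R l ∧ not (K c l))  ≤⟨ +-monoˡ-≤ _ K≤2q ⟩
            q + q + count (λ l → A R l ∧ not (K c l)) ∎
            where
            split : ∀ l → A R l ≡ true → K c l ≡ true ⊎ A R l ∧ not (K c l) ≡ true
            split l Al with K c l
            ... | true  = inj₁ refl
            ... | false = inj₂ (cong (_∧ true) Al)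
          inRow : ∀ l → A R l ∧ not (K c l) ≡ true → row (τ ⟨$⟩ʳ l) ≡ true
          inRow l e = cong₂ _∧_
            (cong₂ _∧_ (critical-free {c} crit) (trans (extends-free R {τ} ext l) (∧-conicalˡ _ _ e)))
            (critical-monotone {c} crit (∧-conicalˡ _ _ e)
              (⌊⌋-false⁻¹ (critical? c l) (not-injective (∧-conicalʳ (A R l) _ e))))

        -- Each of the more than q critical pigeons contributes a row of at least q free cells.
        medium-cells : ∀ {c} → q < count (K c) → count (K c) ≤ q + q → q * q ≤ cells R (M c)
        medium-cells {c} q<K K≤2q = begin
          q * q                          ≤⟨ *-monoˡ-≤ q (<⇒≤ q<K) ⟩
          count (K c) * q                ≡⟨ *-distribʳ-sum q (⟦_⟧ ∘ K c) ⟩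
          sum (λ i → ⟦ K c i ⟧ * q)      ≤⟨ sum-mono rows ⟩
          cells R (M c)                  ∎
          where
          open ≤-Reasoning
          rows : ∀ i → ⟦ K c i ⟧ * q ≤ count (λ j → (A R i ∧ H R j) ∧ M c i j)
          rows i with K c i in eq
          ... | false = z≤n
          ... | true  = ≤-trans (≤-reflexive (+-identityʳ q)) (critical-row {c} (K⇒ {c} eq) K≤2q)

        module _ (0<q : 0 < q) (small : ∀ c → Unsatisfied R (M c) → cells R (M c) < q * q) where

          count-K-small : ∀ c → count (K c) ≤ q + q → count (K c) ≤ q
          count-K-small c K≤2q = ≮⇒≥ λ q<K →
            -- The bound `small` speaks of unsatisfied clauses only; any critical pigeon shows that
            -- `c` is one.
            case sum-positive (⟦_⟧ ∘ K c) (≤-trans (s≤s z≤n) q<K) of λ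
            { (i , 0<K) → <⇒≱ (small c (critical-unsatisfied {c} (K⇒ {c} (0<⟦⟧⇒true 0<K))))
                              (medium-cells {c} q<K K≤2q) }

          -- An inference at most doubles the bound q on the measure, and by `count-K-small` no
          -- measure lies above q and up to 2q, so the gap is never crossed.
          count-K-≤ : ∀ c → Acc (TransClosure Edge) c → count (K c) ≤ q
          count-K-≤ c (acc rec) = count-K-small c (bound (inference c) λ p p∈ → count-K-≤ p (rec [ p∈ ]))
            where
            bound : (inf : Inference _ label c) →
                    (∀ p → p ∈ predecessors inf → count (K p) ≤ q) → count (K c) ≤ q + q
            bound (initial any) _ = ≤-trans (count-K-initial {c} any) (≤-trans 0<q (m≤m+n q q))
            bound (resolve p p′ P Q v p≈ p′≈ c≈) ih =
              ≤-trans (count-K-resolve {c} {p} {p′} p≈ p′≈ c≈)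
                (+-mono-≤ (ih p (here refl)) (ih p′ (there (here refl))))
            bound (weaken p l c≈) ih =
              ≤-trans (count-K-weaken {c} {p} c≈)
                (≤-trans (ih p (here refl)) (m≤m+n q q))

          small-absurd : ⊥
          small-absurd = <⇒≱ (begin-strict
            q               <⟨ m<m+n q (≤-trans 0<q (m≤m+n q q)) ⟩
            q + (q + q)     ≤⟨ 3q≤A ⟩
            count (A R)     ≤⟨ count-mono (A R) (K sink) (λ i Ai → K⇐ {sink} (critical-sink Ai)) ⟩
            count (K sink)  ∎)
            (count-K-≤ sink (edge-wellFounded sink))
            where open ≤-Reasoning

    large-clause : ∀ q → 0 < q → q + (q + q) ≤ count (A R) →
                   ¬ (∀ c → Unsatisfied R (M c) → cells R (M c) < q * q)
    large-clause q 0<q 3q≤A small =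
      critical-decidable λ critical? → small-absurd critical? q 3q≤A 0<q small

-- Popular cells.

module _ {S : ℕ} (R : Restriction (suc m)) (M : Fin S → Fin (suc m) → Fin (suc m) → Bool)
         (L : Fin S → Bool) where

  hits : Fin (suc m) → Fin (suc m) → Fin S → Bool
  hits i j c = (A R i ∧ H R j) ∧ (L c ∧ M c i j)

  remaining : Fin (suc m) → Fin (suc m) → Fin S → Bool
  remaining i j c = L c ∧ not (M c i j)

  -- Double counting of the pairs of a clause in `L` and a free cell of it.
  total-hits : ∀ T → (∀ c → L c ≡ true → T ≤ cells R (M c)) →
               count L * T ≤ sum λ i → sum λ j → count (hits i j)
  total-hits T big = begin
    count L * T                                            ≡⟨ *-distribʳ-sum T (⟦_⟧ ∘ L) ⟩
    sum (λ c → ⟦ L c ⟧ * T)                                ≤⟨ sum-mono bound ⟩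
    sum (λ c → sum λ i → sum λ j → ⟦ hits i j c ⟧)         ≡⟨ ∑-comm (λ c i → sum λ j → ⟦ hits i j c ⟧) ⟩
    sum (λ i → sum λ c → sum λ j → ⟦ hits i j c ⟧)         ≡⟨ sum-cong-≗ (λ i → ∑-comm λ c j → ⟦ hits i j c ⟧) ⟩
    sum (λ i → sum λ j → count (hits i j))                 ∎
    where
    open ≤-Reasoning
    bound : ∀ c → ⟦ L c ⟧ * T ≤ sum λ i → sum λ j → ⟦ hits i j c ⟧
    bound c with L c in eq
    ... | false = z≤n
    ... | true  = ≤-trans (≤-reflexive (+-identityʳ T)) (big c eq)

  -- The n² cells share at least `count L * T` hits, so some cell gets a 1/d fraction of `L`. The
  -- averaging goes over rows, then columns, with `d` multiplied in to avoid division.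
  popular-cell : ∀ d T → suc m * suc m ≤ d * T → (∀ c → L c ≡ true → T ≤ cells R (M c)) →
                 ∃[ i ] ∃[ j ] count L ≤ d * count (hits i j)
  popular-cell d T n²≤dT big with above-average (λ i → d * sum λ j → count (hits i j)) _ (begin
    suc m * (suc m * count L)                             ≡⟨ *-assoc (suc m) (suc m) _ ⟨
    suc m * suc m * count L                               ≤⟨ *-monoˡ-≤ (count L) n²≤dT ⟩
    d * T * count L                                       ≡⟨ *-assoc d T _ ⟩
    d * (T * count L)                                     ≡⟨ cong (d *_) (*-comm T _) ⟩
    d * (count L * T)                                     ≤⟨ *-monoʳ-≤ d (total-hits T big) ⟩
    d * (sum λ i → sum λ j → count (hits i j))            ≡⟨ *-distribˡ-sum d (λ i → sum λ j → count (hits i j)) ⟩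
    sum (λ i → d * sum λ j → count (hits i j))            ∎)
    where open ≤-Reasoning
  ... | i , le = i , above-average (λ j → d * count (hits i j)) (count L)
    (≤-trans le (≤-reflexive (*-distribˡ-sum d (λ j → count (hits i j)))))

  hit : ∀ {i j} → 0 < count (hits i j) → A R i ≡ true × H R j ≡ true × ∃[ c ] M c i j ≡ true
  hit {i} {j} 0<hits with sum-positive (⟦_⟧ ∘ hits i j) 0<hits
  ... | c , 0<c with 0<⟦⟧⇒true 0<c
  ...   | e = ∧-conicalˡ (A R i) _ (∧-conicalˡ _ _ e) , ∧-conicalʳ (A R i) _ (∧-conicalˡ _ _ e) ,
              c , ∧-conicalʳ (L c) _ (∧-conicalʳ (A R i ∧ H R j) _ e)

  remaining-hits : ∀ i j → count (remaining i j) + count (hits i j) ≤ count L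
  remaining-hits i j = begin
    count (remaining i j) + count (hits i j)            ≡⟨ ∑-distrib-+ (⟦_⟧ ∘ remaining i j) (⟦_⟧ ∘ hits i j) ⟨
    sum (λ c → ⟦ remaining i j c ⟧ + ⟦ hits i j c ⟧)    ≤⟨ sum-mono (λ c → disjoint (L c) (M c i j) (A R i ∧ H R j)) ⟩
    count L                                             ∎
    where
    open ≤-Reasoning
    disjoint : ∀ l x b → ⟦ l ∧ not x ⟧ + ⟦ b ∧ (l ∧ x) ⟧ ≤ ⟦ l ⟧
    disjoint true  true  true  = ≤-refl
    disjoint true  true  false = z≤n
    disjoint true  false true  = ≤-refl
    disjoint true  false false = ≤-refl
    disjoint false _     true  = ≤-refl
    disjoint false _     false = ≤-refl

  remaining-few : ∀ e {i j} → count L ≤ suc e * count (hits i j) →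
                  suc e * count (remaining i j) ≤ e * count L
  remaining-few e {i} {j} popular = +-cancelˡ-≤ (count L) _ _ (begin
    count L + suc e * count (remaining i j)                     ≤⟨ +-monoˡ-≤ _ popular ⟩
    suc e * count (hits i j) + suc e * count (remaining i j)    ≡⟨ *-distribˡ-+ (suc e) (count (hits i j)) _ ⟨
    suc e * (count (hits i j) + count (remaining i j))          ≡⟨ cong (suc e *_) (+-comm (count (hits i j)) _) ⟩
    suc e * (count (remaining i j) + count (hits i j))          ≤⟨ *-monoʳ-≤ (suc e) (remaining-hits i j) ⟩
    suc e * count L                                             ∎)
    where open ≤-Reasoning

-- The greedy restriction and the size bound.

module _ {m : ℕ} (ref : Refutation (embed (noneTrue (suc m)) 1))
         (e q : ℕ) (0<q : 0 < q) (n²≤ : suc m * suc m ≤ suc e * (q * q)) where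
  open Refutation ref using (label)

  module _ (R : Restriction (suc m)) (L : Fin (size ref) → Bool) where

    large : Fin (size ref) → Bool
    large c = L c ∧ ⌊ q * q ≤? cells R (M ref c) ⌋

    Covers : Set
    Covers = ∀ c → Unsatisfied R (M ref c) → q * q ≤ cells R (M ref c) → L c ≡ true

    large-complete : Covers → ∀ c → Unsatisfied R (M ref c) → q * q ≤ cells R (M ref c) → large c ≡ true
    large-complete covers c unsat big = cong₂ _∧_ (covers c unsat big) (⌊⌋-true (q * q ≤? _) big)

    large-big : ∀ c → large c ≡ true → q * q ≤ cells R (M ref c)
    large-big c large = ⌊⌋-true⁻¹ (q * q ≤? _) (∧-conicalʳ (L c) _ large)

    large-positive : H R zero ≡ true → Covers → q + (q + q) ≤ count (A R) → 0 < count large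
    large-positive H₀ covers 3q≤A = ≰⇒> λ none →
      large-clause ref R H₀ q 0<q 3q≤A λ c unsat → ≰⇒> λ big →
        n≮0 (≤-trans (count-inhabited large c (large-complete covers c unsat big)) none)

    large-≤ : count large ≤ count L
    large-≤ = count-mono large L λ c → ∧-conicalˡ _ _

  -- Placing a pigeon creates no free cells and keeps satisfied clauses satisfied, while every
  -- clause containing the placed cell becomes satisfied and may be dropped.
  remaining-covers : ∀ R L {i j} (Ai : A R i ≡ true) (Hj : H R j ≡ true) → Covers R L →
                     Covers (place R Ai Hj) (remaining R (M ref) (large R L) i j)
  remaining-covers R L Ai Hj covers c unsat big = cong₂ (λ x y → x ∧ not y)
    (large-complete R L covers c (proj₁ (place-unsatisfied⇒ R Ai Hj {M ref c} unsat))
      (≤-trans big (place-cells R Ai Hj (M ref c))))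
    (proj₂ (place-unsatisfied⇒ R Ai Hj {M ref c} unsat))

  -- Here `t` is the number of rounds left. A round costs one pigeon and shrinks the list by the
  -- factor e/(e+1); the 3q pigeons in reserve keep `large-clause` applicable to the end.
  no-cover : ∀ t R L → H R zero ≡ true → Covers R L → t + (q + (q + q)) ≤ count (A R) →
             count L * e ^ t < suc e ^ t → ⊥
  -- Without rounds left, `few` makes `L` empty, yet it must contain a large clause.
  no-cover zero R L H₀ covers 3q≤A few = <⇒≱ (large-positive R L H₀ covers 3q≤A)
    (≤-trans (large-≤ R L) (≤-trans (≤-reflexive (sym (*-identityʳ _))) (s≤s⁻¹ few)))
  no-cover (suc t) R L H₀ covers t+3q≤A few =
    step (popular-cell R (M ref) (large R L) (suc e) (q * q) n²≤ (large-big R L))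
    where
    positive : ∀ {x y} → 0 < x → x ≤ suc e * y → 0 < y
    positive {y = suc _} _ _ = s≤s z≤n
    positive {y = zero} 0<x le = contradiction (≤-trans 0<x (≤-trans le (≤-reflexive (*-zeroʳ e)))) n≮0
    fewer : ∀ l N r → N ≤ l → suc e * r ≤ e * N → l * e ^ suc t < suc e ^ suc t →
            r * e ^ t < suc e ^ t
    fewer l N r N≤l er≤ l< = *-cancelˡ-< (suc e) _ _ (begin-strict
      suc e * (r * e ^ t)      ≡⟨ *-assoc (suc e) r _ ⟨
      suc e * r * e ^ t        ≤⟨ *-monoˡ-≤ (e ^ t) (≤-trans er≤ (*-monoʳ-≤ e N≤l)) ⟩
      e * l * e ^ t            ≡⟨ cong (_* e ^ t) (*-comm e l) ⟩
      l * e * e ^ t            ≡⟨ *-assoc l e _ ⟩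
      l * (e * e ^ t)          <⟨ l< ⟩
      suc e * suc e ^ t        ∎)
      where open ≤-Reasoning
    step : ∃[ i ] ∃[ j ] count (large R L) ≤ suc e * count (hits R (M ref) (large R L) i j) → ⊥
    -- Large clauses exist, so the popular cell has a hit; hence it is free and lies in some
    -- `M ref c`.
    step (i , j , popular) = place-hit (hit R (M ref) (large R L) {i} {j}
      (positive (large-positive R L H₀ covers (≤-trans (m≤n+m _ (suc t)) t+3q≤A)) popular))
      where
      place-hit : A R i ≡ true × H R j ≡ true × (∃[ c ] M ref c i j ≡ true) → ⊥
      place-hit (Ai , Hj , c , Mij) =
        no-cover t (place R Ai Hj) (remaining R (M ref) (large R L) i j)
          -- The value `zero` stays free because no clause has a cell in that column.
          (place-H⇐ R Ai Hj H₀ λ { refl → true≢false Mij (monotone-zero (label c) i) })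
          (remaining-covers R L Ai Hj covers)
          (s≤s⁻¹ (≤-trans t+3q≤A (place-count R Ai Hj)))
          (fewer (count L) (count (large R L)) _ (large-≤ R L)
            (remaining-few R (M ref) (large R L) e popular) few)

  -- The start is the empty matching with all clauses; of the 4q pigeons, q pay for the rounds and
  -- 3q are the reserve.
  size-lower-bound : q + (q + (q + q)) ≤ suc m → ¬ size ref * e ^ q < suc e ^ q
  size-lower-bound 4q≤n few = no-cover q
    (record { σ = Perm.id ; A = λ _ → true }) (λ _ → true) refl (λ _ _ _ → refl)
    (≤-trans 4q≤n (≤-reflexive (sym (count-full _ λ _ → refl))))
    (subst (λ s → s * e ^ q < suc e ^ q) (sym (count-full {size ref} _ λ _ → refl)) few)

-- The hard formulas and their size.

weight-none : (α : Fin n → Bool) → (∀ i → α i ≡ false) → weight α ≡ 0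
weight-none {zero}  α none = refl
weight-none {suc n} α none rewrite none zero = weight-none (α ∘ suc) (none ∘ suc)

noneTrue-is3CNF : ∀ n → Is3CNF (noneTrue n)
noneTrue-is3CNF n = All.map⁺ (All.tabulate⁺ {f = λ i → i} λ _ → s≤s z≤n)

noneTrue-contradiction : ∀ n → WeightedContradiction (noneTrue n) 1
noneTrue-contradiction n α w≡1 α⊨ =
  case trans (sym w≡1) (weight-none α (All.tabulate⁻ {f = λ i → i} (All.map falsified (All.map⁻ α⊨)))) of λ ()
  where
  falsified : ∀ {i} → Any (λ l → eval α l ≡ true) (neg i ∷ []) → α i ≡ false
  falsified (here e) = not-injective e

-- Crude, as the length is logarithmic, but enough for a polynomial bound on the formula size.
length-encodeℕᵇ : ∀ b → length (encodeℕᵇ b) ≤ ℕᵇ.toℕ b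
length-encodeℕᵇ ℕᵇ.zero  = z≤n
length-encodeℕᵇ 2[1+ b ] = s≤s (≤-trans (length-encodeℕᵇ b) (m≤m+n _ _))
length-encodeℕᵇ 1+[2 b ] = s≤s (≤-trans (length-encodeℕᵇ b) (m≤m+n _ _))

length-concatMap-≤ : {X Y : Set} (g : X → List Y) (b : ℕ) {xs : List X} →
                     All (λ x → length (g x) ≤ b) xs → length (concatMap g xs) ≤ length xs * b
length-concatMap-≤ g b []                   = z≤n
length-concatMap-≤ g b (_∷_ {x} g≤b gs≤b) = ≤-trans (≤-reflexive (length-++ (g x)))
  (+-mono-≤ g≤b (length-concatMap-≤ g b gs≤b))

∥noneTrue∥ : ∀ n → ∥ noneTrue n ∥ ≤ n + n * (2 + n)
∥noneTrue∥ n = begin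
  length (encode (noneTrue n))
    ≡⟨ length-++ (replicate n variable!) ⟩
  length (replicate n variable!) + length (concatMap encodeClause (noneTrue n))
    ≤⟨ +-mono-≤ (≤-reflexive (length-replicate n))
         (length-concatMap-≤ encodeClause (2 + n) (All.map⁺ (All.tabulate⁺ {f = λ i → i} clause))) ⟩
  n + length (noneTrue n) * (2 + n)
    ≡⟨ cong (λ l → n + l * (2 + n)) (trans (length-map _ (allFin n)) (length-tabulate {n = n} λ i → i)) ⟩
  n + n * (2 + n) ∎
  where
  open ≤-Reasoning
  clause : ∀ i → length (encodeClause {n} (neg i ∷ [])) ≤ 2 + n
  -- The two extra symbols are `clause!` and `minus`.
  clause i = s≤s (s≤s (begin
    length (encodeℕᵇ (ℕᵇ.fromℕ (toℕ i)) ++ []) ≡⟨ cong length (++-identityʳ (encodeℕᵇ (ℕᵇ.fromℕ (toℕ i)))) ⟩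
    length (encodeℕᵇ (ℕᵇ.fromℕ (toℕ i)))       ≤⟨ length-encodeℕᵇ (ℕᵇ.fromℕ (toℕ i)) ⟩
    ℕᵇ.toℕ (ℕᵇ.fromℕ (toℕ i))                  ≡⟨ toℕ-fromℕ (toℕ i) ⟩
    toℕ i                                      ≤⟨ Fin.toℕ≤n i ⟩
    n                                          ∎))

-- Estimates with powers of two.

n<2^n : ∀ n → n < 2 ^ n
n<2^n zero    = s≤s z≤n
n<2^n (suc n) = ≤-trans (+-mono-≤ (m^n>0 2 n) (n<2^n n)) (+-monoʳ-≤ (2 ^ n) (m≤m+n _ 0))

∥noneTrue∥-≤ : ∀ n a → 2 + n ≤ 2 ^ a → ∥ noneTrue n ∥ ≤ 2 ^ suc (a + a)
∥noneTrue∥-≤ n a 2+n≤2^a = begin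
  ∥ noneTrue n ∥                         ≤⟨ ∥noneTrue∥ n ⟩
  n + n * (2 + n)                        ≤⟨ +-mono-≤ n≤2^a (*-mono-≤ n≤2^a 2+n≤2^a) ⟩
  2 ^ a + 2 ^ a * 2 ^ a                  ≤⟨ +-mono-≤ (m≤m*n (2 ^ a) (2 ^ a) ⦃ m^n≢0 2 a ⦄) (m≤m+n _ 0) ⟩
  2 * (2 ^ a * 2 ^ a)                    ≡⟨ cong (2 *_) (^-distribˡ-+-* 2 a a) ⟨
  2 ^ suc (a + a)                        ∎
  where
  open ≤-Reasoning
  n≤2^a : n ≤ 2 ^ a
  n≤2^a = ≤-trans (m≤n+m n 2) 2+n≤2^a

-- The choice p = 2r with r = F + 20c gives 2^p ≥ (r + 1)², which beats the
-- exponent F + c(17 + 2p) = F + 17c + 4rc.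
exponent-bound : ∀ F c → let r = F + 20 * c in
                 F + suc ((8 + (r + r)) + (8 + (r + r))) * c < 2 ^ (r + r)
exponent-bound F c = begin-strict
  F + suc ((8 + (r + r)) + (8 + (r + r))) * c   ≡⟨ expand F c r ⟩
  (F + 17 * c) + r * (4 * c)                    ≤⟨ +-mono-≤ (+-monoʳ-≤ F (*-monoˡ-≤ c (≤ᵇ⇒≤ 17 20 _)))
                                                     (*-monoʳ-≤ r (≤-trans (*-monoˡ-≤ c (≤ᵇ⇒≤ 4 20 _)) (m≤n+m _ F))) ⟩
  r + r * r                                     <⟨ +-mono-<-≤ (n<1+n r) (*-monoʳ-≤ r (n≤1+n r)) ⟩
  suc r * suc r                                 ≤⟨ *-mono-≤ (n<2^n r) (n<2^n r) ⟩
  2 ^ r * 2 ^ r                                 ≡⟨ ^-distribˡ-+-* 2 r r ⟨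
  2 ^ (r + r)                                   ∎
  where
  open ≤-Reasoning
  r : ℕ
  r = F + 20 * c
  expand : ∀ F c r → F + suc ((8 + (r + r)) + (8 + (r + r))) * c ≡ (F + 17 * c) + r * (4 * c)
  expand = solve-∀

^-distribʳ-* : ∀ n a b → (a * b) ^ n ≡ a ^ n * b ^ n
^-distribʳ-* zero    a b = refl
^-distribʳ-* (suc n) a b =
  trans (cong (a * b *_) (^-distribʳ-* n a b)) ([m*n]*[o*p]≡[m*o]*[n*p] a b (a ^ n) (b ^ n))

-- Every `d` factors b/a gain at least a factor 2, so `d * r` of them outweigh `s`.
exponential-gap : ∀ a b d r {s} .{{_ : NonZero a}} → 2 * a ^ d ≤ b ^ d → s < 2 ^ r →
                  s * a ^ (d * r) < b ^ (d * r)
exponential-gap a b d r {s} 2aᵈ≤bᵈ s<2ʳ = begin-strict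
  s * a ^ (d * r)           <⟨ *-monoˡ-< (a ^ (d * r)) ⦃ m^n≢0 a (d * r) ⦄ s<2ʳ ⟩
  2 ^ r * a ^ (d * r)       ≡⟨ cong (2 ^ r *_) (^-*-assoc a d r) ⟨
  2 ^ r * (a ^ d) ^ r       ≡⟨ ^-distribʳ-* r 2 (a ^ d) ⟨
  (2 * a ^ d) ^ r           ≤⟨ ^-monoˡ-≤ r 2aᵈ≤bᵈ ⟩
  (b ^ d) ^ r               ≡⟨ ^-*-assoc b d r ⟩
  b ^ (d * r)               ∎
  where open ≤-Reasoning

-- Choice of parameters and conclusion.

pigeons : ℕ → ℕ
pigeons q = suc (q + (q + (q + q)))

module _ {q : ℕ} (0<q : 0 < q) where
  open ≤-Reasoning

  -- The 25 comes from 4q + 1 ≤ 5q, as q is positive.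
  pigeons-square : pigeons q * pigeons q ≤ 25 * (q * q)
  pigeons-square = begin
    pigeons q * pigeons q                ≤⟨ *-mono-≤ n≤5q n≤5q ⟩
    (q + (q + (q + (q + q)))) * (q + (q + (q + (q + q)))) ≡⟨ square q ⟩
    25 * (q * q)                         ∎
    where
    n≤5q : pigeons q ≤ q + (q + (q + (q + q)))
    n≤5q = +-monoˡ-≤ (q + (q + (q + q))) 0<q
    square : ∀ q → (q + (q + (q + (q + q)))) * (q + (q + (q + (q + q)))) ≡ 25 * (q * q)
    square = solve-∀

  pigeons-≤ : 2 + pigeons q ≤ 2 * (2 * (2 * q))
  pigeons-≤ = begin
    3 + (q + (q + (q + q)))                      ≤⟨ +-monoˡ-≤ _ (+-mono-≤ 0<q (+-mono-≤ 0<q (≤-trans 0<q (m≤m+n q q)))) ⟩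
    q + (q + (q + q)) + (q + (q + (q + q)))      ≡⟨ double q ⟩
    2 * (2 * (2 * q))                            ∎
    where
    double : ∀ q → q + (q + (q + q)) + (q + (q + (q + q))) ≡ 2 * (2 * (2 * q))
    double = solve-∀

-- A round leaves a fraction of at most 24/25, and 32 rounds at least halve the list, since 2 · 24³²
-- ≤ 25³². As 32 is a power of two, so is q = 32 · 2ᵖ.
size-≥ : ∀ p (ref : Refutation (embed (noneTrue (pigeons (2 ^ (5 + p)))) 1)) → ¬ size ref < 2 ^ (2 ^ p)
size-≥ p ref small = size-lower-bound ref 24 q 0<q (pigeons-square 0<q) (n≤1+n _)
  (subst (λ q → size ref * 24 ^ q < 25 ^ q) (sym (^-distribˡ-+-* 2 5 p))
    (exponential-gap 24 25 32 (2 ^ p) (≤ᵇ⇒≤ (2 * 24 ^ 32) (25 ^ 32) _) small))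
  where
  q : ℕ
  q = 2 ^ (5 + p)
  0<q : 0 < q
  0<q = m^n>0 2 (5 + p)

corollary6 : ¬ (Σ[ f ∈ (ℕ → ℕ) ] Σ[ c ∈ ℕ ] (Computable f ×
    (∀ (n k : ℕ) (Φ : CNF (Fin n)) → k ≤ n → Is3CNF Φ → WeightedContradiction Φ k →
    Σ[ π ∈ Refutation (embed Φ k) ] (size π ≤ f k * ∥ Φ ∥ ^ c))))
corollary6 (f , c , _ , bounded) = size-≥ p (proj₁ refutation) (begin-strict
  size (proj₁ refutation)                 ≤⟨ proj₂ refutation ⟩
  f 1 * ∥ noneTrue N ∥ ^ c                ≤⟨ *-mono-≤ (<⇒≤ (n<2^n (f 1)))
                                              (^-monoˡ-≤ c (∥noneTrue∥-≤ N a (pigeons-≤ (m^n>0 2 (5 + p))))) ⟩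
  2 ^ f 1 * (2 ^ suc (a + a)) ^ c         ≡⟨ cong (2 ^ f 1 *_) (^-*-assoc 2 (suc (a + a)) c) ⟩
  2 ^ f 1 * 2 ^ (suc (a + a) * c)         ≡⟨ ^-distribˡ-+-* 2 (f 1) _ ⟨
  2 ^ (f 1 + suc (a + a) * c)             <⟨ ^-monoʳ-< 2 (s≤s (s≤s z≤n)) (exponent-bound (f 1) c) ⟩
  2 ^ (2 ^ p)                             ∎)
  where
  open ≤-Reasoning
  p a N : ℕ
  -- This is the 2r of `exponent-bound` with F = f 1. As k is fixed to 1, `f 1` is a constant and
  -- `N` may depend on it.
  p = (f 1 + 20 * c) + (f 1 + 20 * c)
  -- By `pigeons-≤`, 2 + N is at most 8 times 2 ^ (5 + p), which is 2 ^ a.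
  a = 8 + p
  N = pigeons (2 ^ (5 + p))
  refutation : Σ[ π ∈ Refutation (embed (noneTrue N) 1) ] (size π ≤ f 1 * ∥ noneTrue N ∥ ^ c)
  refutation = bounded N 1 (noneTrue N) (s≤s z≤n) (noneTrue-is3CNF N) (noneTrue-contradiction N)
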